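{- Let $m\geq 0$ and $k\geq 1$ be integers and let $n$ be a nonnegative integer with $n\geq t(m,k)$, where \[ t(m,k)= m\left(\left\lfloor \frac{m}{k}\right\rfloor +1\right)k-\binom{\lfloor m/k\rfloor +1}{2}k^2 . \] Then $b(n,k)\geq m$.
   Context: For a cell $u$ of the Young diagram of a partition $\lambda$, the hook length of $u$ is the number of cells $v$ of the diagram with $v=u$, or $v$ below $u$ in the same column, or $v$ to the right of $u$ in the same row. $\alpha_k(\lambda)$ is the number of cells of the Young diagram of $\lambda$ with hook length exactly $k$. $P(n)$ is the set of partitions of $n$ (with $P(0)$ containing only the empty partition), and $b(n,k)=\max\{\alpha_k(\lambda)\colon\lambda\in P(n)\}$. -}

module Defs where

open import Data.List.Base
  using (List; []; _∷_; _++_; map; filter; length; upTo; replicate; cartesianProductWith)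
open import Data.List.Extrema.Nat using (max; xs≤max; argmax-sel)
open import Data.List.Membership.Propositional using (_∈_)
open import Data.List.Membership.Propositional.Properties
  using (∈-filter⁺; ∈-filter⁻; ∈-map⁺; ∈-map⁻; ∈-upTo⁺; ∈-cartesianProductWith⁺)
open import Data.List.Relation.Unary.All as All using (All; []; _∷_; all?)
open import Data.List.Relation.Unary.Any using (here; there)
open import Data.List.Relation.Unary.Linked using (Linked; []; [-]; _∷_; linked?)
open import Data.Nat.Base
open import Data.Nat.Combinatorics using (_C_; nC1≡n; nCk+nC[k+1]≡[n+1]C[k+1])
open import Data.Nat.DivMod using (_/_; m/n*n≤m)
open import Data.Nat.ListAction using (sum)
open import Data.Nat.Properties
open import Data.Product.Base using (_×_; _,_; proj₁; proj₂; ∃-syntax; map₁)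
open import Data.Sum.Base using (_⊎_; inj₁; inj₂)
open import Function.Base using (id)
open import Function.Bundles using (_⇔_; mk⇔; module Equivalence)
open import Relation.Binary.PropositionalEquality using (_≡_; refl; sym; cong; cong₂)
open import Relation.Nullary.Decidable using (Dec; _×-dec_; _⊎-dec_)
open import Relation.Unary using (Decidable)

IsPartition : ℕ → List ℕ → Set
IsPartition n ps = All (_> 0) ps × Linked _≥_ ps × sum ps ≡ n

isPartition? : ∀ n → Decidable (IsPartition n)
isPartition? n ps = all? (_>? 0) ps ×-dec linked? _≥?_ ps ×-dec sum ps ≟ n

boundedLists : ℕ → ℕ → List (List ℕ)
boundedLists n zero    = [] ∷ []
boundedLists n (suc l) =
  [] ∷ cartesianProductWith _∷_ (upTo (suc n)) (boundedLists n l)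

-- A partition of n has at most n parts, each at most n, so this lists all
-- of P(n); see ∈-P below.
P : ℕ → List (List ℕ)
P n = filter (isPartition? n) (boundedLists n n)

-- The cell (i , j) lies in row i and column j, both counted from 0, with
-- rows going downwards: it belongs to the diagram when j is less than the
-- i-th part.
Cell : Set
Cell = ℕ × ℕ

cells : List ℕ → List Cell
cells []       = []
cells (p ∷ ps) = map (0 ,_) (upTo p) ++ map (map₁ suc) (cells ps)

_Below_ : Cell → Cell → Set
(i′ , j′) Below (i , j) = i′ > i × j′ ≡ j

_RightOf_ : Cell → Cell → Set
(i′ , j′) RightOf (i , j) = i′ ≡ i × j′ > j

_InHookOf_ : Cell → Cell → Set
v InHookOf u = v ≡ u ⊎ v Below u ⊎ v RightOf u

_≟ᶜ_ : (v u : Cell) → Dec (v ≡ u)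
_≟ᶜ_ = ≡-dec _≟_ _≟_
  where open import Data.Product.Properties using (≡-dec)

_inHookOf?_ : (v u : Cell) → Dec (v InHookOf u)
v@(i′ , j′) inHookOf? u@(i , j) =
  (v ≟ᶜ u) ⊎-dec ((i′ >? i) ×-dec (j′ ≟ j)) ⊎-dec ((i′ ≟ i) ×-dec (j′ >? j))

hookLength : List ℕ → Cell → ℕ
hookLength ps u = length (filter (_inHookOf? u) (cells ps))

α : ℕ → List ℕ → ℕ
α k ps = length (filter (λ u → hookLength ps u ≟ k) (cells ps))

-- The base value 0 does not affect the maximum, since P(n) is never empty;
-- see b-attained and b-upper below.
b : ℕ → ℕ → ℕ
b n k = max 0 (map (α k) (P n))

-- The subtraction never truncates; see t-exact below.
t : (m k : ℕ) .{{_ : NonZero k}} → ℕ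
t m k = m * (m / k + 1) * k ∸ ((m / k + 1) C 2) * k ^ 2

private
  length≤sum : ∀ {ps} → All (_> 0) ps → length ps ≤ sum ps
  length≤sum []       = z≤n
  length≤sum (p ∷ ps) = +-mono-≤ p (length≤sum ps)

  parts≤sum : ∀ ps → All (_≤ sum ps) ps
  parts≤sum []       = []
  parts≤sum (p ∷ ps) =
    m≤m+n p (sum ps) ∷ All.map (λ q≤ → ≤-trans q≤ (m≤n+m (sum ps) p)) (parts≤sum ps)

  ∈-boundedLists : ∀ {n} l {ps} → length ps ≤ l → All (_≤ n) ps → ps ∈ boundedLists n l
  ∈-boundedLists zero    {[]}    _         _          = here refl
  ∈-boundedLists (suc l) {[]}    _         _          = here refl
  ∈-boundedLists (suc l) {_ ∷ _} (s≤s len) (p≤ ∷ ps≤) =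
    there (∈-cartesianProductWith⁺ _∷_ (∈-upTo⁺ (s≤s p≤)) (∈-boundedLists l len ps≤))

∈-P : ∀ n ps → ps ∈ P n ⇔ IsPartition n ps
∈-P n ps = mk⇔ (λ ps∈ → proj₂ (∈-filter⁻ (isPartition? n) {xs = boundedLists n n} ps∈)) from
  where
  from : IsPartition n ps → ps ∈ P n
  from isP@(pos , _ , refl) =
    ∈-filter⁺ (isPartition? n) (∈-boundedLists n (length≤sum pos) (parts≤sum ps)) isP

b-upper : ∀ n k {ps} → IsPartition n ps → α k ps ≤ b n k
b-upper n k {ps} isP =
  All.lookup (xs≤max 0 (map (α k) (P n))) (∈-map⁺ (α k) (Equivalence.from (∈-P n ps) isP))

private
  ones : ∀ n → IsPartition n (replicate n 1)
  ones n = pos n , dec n , tot n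
    where
    pos : ∀ n → All (_> 0) (replicate n 1)
    pos zero    = []
    pos (suc n) = s≤s z≤n ∷ pos n
    dec : ∀ n → Linked _≥_ (replicate n 1)
    dec zero          = []
    dec (suc zero)    = [-]
    dec (suc (suc n)) = ≤-refl ∷ dec (suc n)
    tot : ∀ n → sum (replicate n 1) ≡ n
    tot zero    = refl
    tot (suc n) = cong suc (tot n)

b-attained : ∀ n k → ∃[ ps ] IsPartition n ps × α k ps ≡ b n k
b-attained n k with argmax-sel id 0 (map (α k) (P n))
... | inj₁ b≡0 = replicate n 1 , ones n ,
  ≤-antisym (b-upper n k (ones n)) (≤-trans (≤-reflexive b≡0) z≤n)
... | inj₂ b∈ with ∈-map⁻ (α k) b∈
...   | ps , ps∈ , b≡α = ps , Equivalence.to (∈-P n ps) ps∈ , sym b≡α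

private
  C2≤ : ∀ q → (q + 1) C 2 ≤ q * (q + 1)
  C2≤ zero    = z≤n
  C2≤ (suc q) = begin
    (suc q + 1) C 2            ≡⟨ sym (cong (λ x → suc x C 2) (+-comm 1 q)) ⟩
    suc (suc q) C 2            ≡⟨ sym (nCk+nC[k+1]≡[n+1]C[k+1] (suc q) 1) ⟩
    suc q C 1 + suc q C 2      ≡⟨ cong₂ _+_ (nC1≡n (suc q)) (cong (_C 2) (+-comm 1 q)) ⟩
    suc q + (q + 1) C 2        ≤⟨ +-monoʳ-≤ (suc q) (C2≤ q) ⟩
    suc q + q * (q + 1)        ≤⟨ +-mono-≤ (m≤m+n (suc q) 1) (*-monoʳ-≤ q (n≤1+n (q + 1))) ⟩
    suc q * (suc q + 1)        ∎
    where open ≤-Reasoning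

t-exact : ∀ m k .{{_ : NonZero k}} →
  t m k + ((m / k + 1) C 2) * k ^ 2 ≡ m * (m / k + 1) * k
t-exact m k = m∸n+n≡m bound
  where
  open ≤-Reasoning
  q = m / k
  open import Data.Nat.Solver using (module +-*-Solver)
  open +-*-Solver
  bound : ((q + 1) C 2) * k ^ 2 ≤ m * (q + 1) * k
  bound = begin
    ((q + 1) C 2) * k ^ 2   ≤⟨ *-monoˡ-≤ (k ^ 2) (C2≤ q) ⟩
    q * (q + 1) * k ^ 2     ≡⟨ solve 2 (λ q k → q :* (q :+ con 1) :* k :^ 2
                                             := q :* k :* (q :+ con 1) :* k) refl q k ⟩
    q * k * (q + 1) * k     ≤⟨ *-monoˡ-≤ k (*-monoˡ-≤ (q + 1) (m/n*n≤m m k)) ⟩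
    m * (q + 1) * k         ∎

{-# OPTIONS --safe #-}
-- Read bottom-up, a row of length p placed on top of ps acquires a k-hook in
-- column j when p − j plus the height of column j in ps is k, and the hooks in
-- ps are unchanged. Write m = q k + r with 1 ≤ r ≤ k. Stacking k rows of each
-- length k, 2k, …, qk and then r rows of length (q + 1) k gives a k-hook in
-- every row and uses exactly t(m, k) cells. The d = n − t(m, k) extra cells
-- are placed as follows.
--   * If d ≥ k, they lengthen the top row.
--   * If d < k and r < k or d = 0, they go to the r top rows as a shape with at
--     most r rows and k − r columns, which keeps the k-hook of each of them: up
--     to k − r cells in the top row, one cell in each of some rows below it.
--   * If 0 < d < k and r = k, start with an extra row of length d below
--     everything and change the rows of length (i + 1) k, for each i ≤ q, into
--     d rows one shorter, k − 1 − d rows unchanged, and one row d longer.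
module Submission where

open import Defs
open import Data.Bool.Base using (true; false)
open import Data.List.Base
  using (List; []; _∷_; _++_; [_]; map; filter; length; upTo; replicate)
open import Data.List.Membership.Propositional.Properties
  using (∈-filter⁺; ∈-upTo⁺; ∈-length)
open import Data.List.Properties
  using (filter-++; filter-≐; filter-none; filter-accept; filter-reject; length-++; upTo-∷ʳ)
open import Data.List.Relation.Unary.All as All using (All; []; _∷_)
open import Data.List.Relation.Unary.All.Properties using (map⁺)
open import Data.List.Relation.Unary.Linked using (Linked; []; [-]; _∷_)
open import Data.Nat using (ℕ; NonZero; _≥_)
open import Data.Nat.Base
  using (zero; suc; _+_; _*_; _∸_; _^_; _≤_; _<_; _>_; z≤n; s≤s; >-nonZero⁻¹)
open import Data.Nat.Combinatorics using (_C_; nC1≡n; nCk+nC[k+1]≡[n+1]C[k+1])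
open import Data.Nat.Divisibility using (divides-refl)
open import Data.Nat.DivMod
  using (_/_; _%_; m≡m%n+[m/n]*n; m%n<n; m<n⇒m/n≡0; m*n/n≡m; +-distrib-/-∣ʳ)
open import Data.Nat.Properties
open import Data.Nat.Solver using (module +-*-Solver)
open import Data.Product.Base using (_×_; _,_; proj₁; proj₂; map₁; ∃-syntax)
open import Data.Sum.Base using (inj₁; inj₂)
open import Function.Base using (_∘_)
open import Relation.Binary.Definitions using (Tri; tri<; tri≈; tri>)
open import Relation.Binary.PropositionalEquality
  using (_≡_; refl; sym; trans; cong; cong₂; subst; subst₂; module ≡-Reasoning)
open import Relation.Nullary using (¬_; Dec; yes; no; does)
open import Relation.Unary using (Pred; Decidable; _≐_; ∁)

open +-*-Solver using (solve; _:+_; _:*_; _:^_; _:=_; con)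

-- Counting the elements of a list that satisfy a predicate

count : ∀ {a p} {A : Set a} {P : Pred A p} → Decidable P → List A → ℕ
count P? xs = length (filter P? xs)

module _ {a p} {A : Set a} {P : Pred A p} (P? : Decidable P) where

  count-++ : ∀ xs ys → count P? (xs ++ ys) ≡ count P? xs + count P? ys
  count-++ xs ys = trans (cong length (filter-++ P? xs ys)) (length-++ (filter P? xs))

  count-none : ∀ {xs} → All (∁ P) xs → count P? xs ≡ 0
  count-none ¬ps = cong length (filter-none P? ¬ps)

  count-accept : ∀ {x} → P x → count P? [ x ] ≡ 1
  count-accept px = cong length (filter-accept P? px)

  count-reject : ∀ {x} → ¬ P x → count P? [ x ] ≡ 0
  count-reject ¬px = cong length (filter-reject P? ¬px)

  count-map : ∀ {b} {B : Set b} (f : B → A) xs → count P? (map f xs) ≡ count (P? ∘ f) xs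
  count-map f []       = refl
  count-map f (x ∷ xs) with does (P? (f x))
  ... | true  = cong suc (count-map f xs)
  ... | false = count-map f xs

count-≐ : ∀ {a p q} {A : Set a} {P : Pred A p} {Q : Pred A q}
          (P? : Decidable P) (Q? : Decidable Q) → P ≐ Q → ∀ xs → count P? xs ≡ count Q? xs
count-≐ P? Q? P≐Q xs = cong length (filter-≐ P? Q? P≐Q xs)

count-upTo-suc : ∀ {ℓ} {P : Pred ℕ ℓ} (P? : Decidable P) p →
                 count P? (upTo (suc p)) ≡ count P? (upTo p) + count P? [ p ]
count-upTo-suc P? p =
  trans (cong (count P?) (sym (upTo-∷ʳ p))) (count-++ P? (upTo p) [ p ])

count-≥-upTo : ∀ j p → count (_≥? j) (upTo p) ≡ p ∸ j
count-≥-upTo j zero    = sym (0∸n≡0 j)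
count-≥-upTo j (suc p) with p ≥? j
... | yes p≥j = begin
  count (_≥? j) (upTo (suc p))                   ≡⟨ count-upTo-suc (_≥? j) p ⟩
  count (_≥? j) (upTo p) + count (_≥? j) [ p ]   ≡⟨ cong₂ _+_ (count-≥-upTo j p) (count-accept (_≥? j) p≥j) ⟩
  p ∸ j + 1                                      ≡⟨ +-comm (p ∸ j) 1 ⟩
  1 + (p ∸ j)                                    ≡⟨ +-∸-assoc 1 p≥j ⟨
  suc p ∸ j                                      ∎
  where open ≡-Reasoning
... | no p≱j = begin
  count (_≥? j) (upTo (suc p))                   ≡⟨ count-upTo-suc (_≥? j) p ⟩
  count (_≥? j) (upTo p) + count (_≥? j) [ p ]   ≡⟨ cong₂ _+_ (count-≥-upTo j p) (count-reject (_≥? j) p≱j) ⟩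
  p ∸ j + 0                                      ≡⟨ +-identityʳ (p ∸ j) ⟩
  p ∸ j                                          ≡⟨ m≤n⇒m∸n≡0 (<⇒≤ (≰⇒> p≱j)) ⟩
  0                                              ≡⟨ m≤n⇒m∸n≡0 (≰⇒> p≱j) ⟨
  suc p ∸ j                                      ∎
  where open ≡-Reasoning

-- The indicator of `p > j` is written as a count over `[ p ]`, the form in which a single row
-- enters `colLength` in `count-column`.
count-≟-upTo : ∀ j p → count (_≟ j) (upTo p) ≡ count (_>? j) [ p ]
count-≟-upTo j zero    = sym (count-reject (_>? j) {0} λ ())
count-≟-upTo j (suc p) = trans (count-upTo-suc (_≟ j) p)
  (trans (cong (_+ count (_≟ j) [ p ]) (count-≟-upTo j p)) (step (<-cmp p j)))
  where
  step : Tri (p < j) (p ≡ j) (p > j) →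
         count (_>? j) [ p ] + count (_≟ j) [ p ] ≡ count (_>? j) [ suc p ]
  step (tri< p<j p≢j p≯j) = trans
    (cong₂ _+_ (count-reject (_>? j) p≯j) (count-reject (_≟ j) p≢j))
    (sym (count-reject (_>? j) (≤⇒≯ p<j)))
  step (tri≈ _ p≡j p≯j) = trans
    (cong₂ _+_ (count-reject (_>? j) p≯j) (count-accept (_≟ j) p≡j))
    (sym (count-accept (_>? j) (s≤s (≤-reflexive (sym p≡j)))))
  step (tri> _ p≢j p>j) = trans
    (cong₂ _+_ (count-accept (_>? j) p>j) (count-reject (_≟ j) p≢j))
    (sym (count-accept (_>? j) (m≤n⇒m≤1+n p>j)))

-- Hook lengths under a new top row

colLength : ℕ → List ℕ → ℕ
colLength j = count (_>? j)

count-column : ∀ j ps → count ((_≟ j) ∘ proj₂) (cells ps) ≡ colLength j ps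
count-column j []       = refl
count-column j (p ∷ ps) = begin
  count ((_≟ j) ∘ proj₂) (map (0 ,_) (upTo p) ++ map (map₁ suc) (cells ps))
    ≡⟨ count-++ ((_≟ j) ∘ proj₂) (map (0 ,_) (upTo p)) _ ⟩
  count ((_≟ j) ∘ proj₂) (map (0 ,_) (upTo p)) + count ((_≟ j) ∘ proj₂) (map (map₁ suc) (cells ps))
    ≡⟨ cong₂ _+_ (count-map ((_≟ j) ∘ proj₂) (0 ,_) (upTo p))
                 (count-map ((_≟ j) ∘ proj₂) (map₁ suc) (cells ps)) ⟩
  count (_≟ j) (upTo p) + count ((_≟ j) ∘ proj₂) (cells ps)
    ≡⟨ cong₂ _+_ (count-≟-upTo j p) (count-column j ps) ⟩
  count (_>? j) [ p ] + colLength j ps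
    ≡⟨ count-++ (_>? j) [ p ] ps ⟨
  colLength j (p ∷ ps) ∎
  where open ≡-Reasoning

-- The hook splits into its part in the new row, with the corner included in `p ∸ j`, and all of
-- column `j` of the old diagram.
hookLength-zero : ∀ p ps j → hookLength (p ∷ ps) (0 , j) ≡ (p ∸ j) + colLength j ps
hookLength-zero p ps j = begin
  hookLength (p ∷ ps) (0 , j)
    ≡⟨ count-++ H? (map (0 ,_) (upTo p)) _ ⟩
  count H? (map (0 ,_) (upTo p)) + count H? (map (map₁ suc) (cells ps))
    ≡⟨ cong₂ _+_ (count-map H? (0 ,_) (upTo p)) (count-map H? (map₁ suc) (cells ps)) ⟩
  count (H? ∘ (0 ,_)) (upTo p) + count (H? ∘ map₁ suc) (cells ps)
    ≡⟨ cong₂ _+_ (count-≐ (H? ∘ (0 ,_)) (_≥? j) (row⇒ , row⇐) (upTo p))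
                 (count-≐ (H? ∘ map₁ suc) ((_≟ j) ∘ proj₂) (col⇒ , col⇐) (cells ps)) ⟩
  count (_≥? j) (upTo p) + count ((_≟ j) ∘ proj₂) (cells ps)
    ≡⟨ cong₂ _+_ (count-≥-upTo j p) (count-column j ps) ⟩
  (p ∸ j) + colLength j ps ∎
  where
  open ≡-Reasoning
  H? = _inHookOf? (0 , j)
  row⇒ : ∀ {j′} → (0 , j′) InHookOf (0 , j) → j′ ≥ j
  row⇒ (inj₁ refl)             = ≤-refl
  row⇒ (inj₂ (inj₂ (_ , j′>j))) = <⇒≤ j′>j
  row⇐ : ∀ {j′} → j′ ≥ j → (0 , j′) InHookOf (0 , j)
  row⇐ j′≥j with m≤n⇒m<n∨m≡n j′≥j
  ... | inj₁ j<j′ = inj₂ (inj₂ (refl , j<j′))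
  ... | inj₂ refl = inj₁ refl
  col⇒ : ∀ {c} → map₁ suc c InHookOf (0 , j) → proj₂ c ≡ j
  col⇒ (inj₂ (inj₁ (_ , eq))) = eq
  col⇐ : ∀ {c} → proj₂ c ≡ j → map₁ suc c InHookOf (0 , j)
  col⇐ eq = inj₂ (inj₁ (s≤s z≤n , eq))

-- Hooks extend only downwards and to the right, so a hook with its corner in an old row never meets
-- the new top row.
hookLength-suc : ∀ p ps c → hookLength (p ∷ ps) (map₁ suc c) ≡ hookLength ps c
hookLength-suc p ps c@(i , j) = begin
  hookLength (p ∷ ps) (suc i , j)
    ≡⟨ count-++ H? (map (0 ,_) (upTo p)) _ ⟩
  count H? (map (0 ,_) (upTo p)) + count H? (map (map₁ suc) (cells ps))
    ≡⟨ cong₂ _+_ (count-none H? (map⁺ (All.universal (λ _ → outside) (upTo p))))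
                 (count-map H? (map₁ suc) (cells ps)) ⟩
  count (H? ∘ map₁ suc) (cells ps)
    ≡⟨ count-≐ (H? ∘ map₁ suc) (_inHookOf? c) (lower , raise) (cells ps) ⟩
  hookLength ps c ∎
  where
  open ≡-Reasoning
  H? = _inHookOf? (suc i , j)
  outside : ∀ {j′} → ¬ (0 , j′) InHookOf (suc i , j)
  outside (inj₂ (inj₁ (() , _)))
  outside (inj₂ (inj₂ (() , _)))
  lower : ∀ {v} → map₁ suc v InHookOf (suc i , j) → v InHookOf c
  lower (inj₁ refl)                 = inj₁ refl
  lower (inj₂ (inj₁ (s≤s i′>i , eq))) = inj₂ (inj₁ (i′>i , eq))
  lower (inj₂ (inj₂ (refl , j′>j)))   = inj₂ (inj₂ (refl , j′>j))
  raise : ∀ {v} → v InHookOf c → map₁ suc v InHookOf (suc i , j)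
  raise (inj₁ refl)                 = inj₁ refl
  raise (inj₂ (inj₁ (i′>i , eq)))     = inj₂ (inj₁ (s≤s i′>i , eq))
  raise (inj₂ (inj₂ (refl , j′>j)))   = inj₂ (inj₂ (refl , j′>j))

α-∷ : ∀ k p ps →
      α k (p ∷ ps) ≡ count (λ j → (p ∸ j) + colLength j ps ≟ k) (upTo p) + α k ps
α-∷ k p ps = begin
  α k (p ∷ ps)
    ≡⟨ count-++ K? (map (0 ,_) (upTo p)) _ ⟩
  count K? (map (0 ,_) (upTo p)) + count K? (map (map₁ suc) (cells ps))
    ≡⟨ cong₂ _+_ (count-map K? (0 ,_) (upTo p)) (count-map K? (map₁ suc) (cells ps)) ⟩
  count (K? ∘ (0 ,_)) (upTo p) + count (K? ∘ map₁ suc) (cells ps)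
    ≡⟨ cong₂ _+_
         (count-≐ (K? ∘ (0 ,_)) _
           ( (λ {j} → trans (sym (hookLength-zero p ps j)))
           , (λ {j} → trans (hookLength-zero p ps j)) ) (upTo p))
         (count-≐ (K? ∘ map₁ suc) _
           ( (λ {c} → trans (sym (hookLength-suc p ps c)))
           , (λ {c} → trans (hookLength-suc p ps c)) ) (cells ps)) ⟩
  count (λ j → (p ∸ j) + colLength j ps ≟ k) (upTo p) + α k ps ∎
  where
  open ≡-Reasoning
  K? = λ u → hookLength (p ∷ ps) u ≟ k

α-∷-< : ∀ {k p} ps j → j < p → (p ∸ j) + colLength j ps ≡ k → α k ps < α k (p ∷ ps)
α-∷-< {k} {p} ps j j<p eq = begin-strict
  α k ps                              <⟨ +-monoˡ-≤ (α k ps) (∈-length (∈-filter⁺ row? (∈-upTo⁺ j<p) eq)) ⟩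
  count row? (upTo p) + α k ps        ≡⟨ α-∷ k p ps ⟨
  α k (p ∷ ps)                        ∎
  where
  open ≤-Reasoning
  row? = λ j → (p ∸ j) + colLength j ps ≟ k

-- Stacking rows that each bring a k-hook

colLength-bounded : ∀ {w j ps} → All (_≤ w) ps → w ≤ j → colLength j ps ≡ 0
colLength-bounded {j = j} ps≤w w≤j =
  count-none (_>? j) (All.map (λ p≤w → ≤⇒≯ (≤-trans p≤w w≤j)) ps≤w)

colLength-∷ : ∀ {j p} ps → j < p → colLength j (p ∷ ps) ≡ suc (colLength j ps)
colLength-∷ {j} {p} ps j<p =
  trans (count-++ (_>? j) [ p ] ps) (cong (_+ colLength j ps) (count-accept (_>? j) j<p))

colLength-replicate-++ : ∀ {j p} s ps → j < p →
                         colLength j (replicate s p ++ ps) ≡ s + colLength j ps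
colLength-replicate-++ zero    ps j<p = refl
colLength-replicate-++ (suc s) ps j<p =
  trans (colLength-∷ (replicate s _ ++ ps) j<p) (cong suc (colLength-replicate-++ s ps j<p))

-- The state of a construction in progress: `ps` has size `n` and at least `m` hooks of length `k`.
-- The width `w` is only an upper bound, so it may be raised without adding a row, and any row of
-- length at least `w` can go on top.
record Stack (k m n w : ℕ) (ps : List ℕ) : Set where
  constructor stack
  field
    isPartition : IsPartition n ps
    bounded     : All (_≤ w) ps
    hooks       : m ≤ α k ps

open Stack

empty : ∀ {k} → Stack k 0 0 0 []
empty = stack ([] , [] , refl) [] z≤n

isPartition-∷ : ∀ {n p ps} → p > 0 → All (_≤ p) ps → IsPartition n ps →
                IsPartition (p + n) (p ∷ ps)
isPartition-∷ {p = p} p>0 ps≤p (pos , sorted , total) =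
  p>0 ∷ pos , extend ps≤p sorted , cong (p +_) total
  where
  extend : ∀ {ps} → All (_≤ p) ps → Linked _≥_ ps → Linked _≥_ (p ∷ ps)
  extend []         []  = [-]
  extend (q≤p ∷ _) qs  = q≤p ∷ qs

-- The hook condition is free of truncated subtraction, so each use reduces to a semiring identity
-- once the column length is known.
stack-row : ∀ {k m n w p ps} j → Stack k m n w ps → w ≤ p → j < p →
            p + colLength j ps ≡ k + j → Stack k (suc m) (p + n) p (p ∷ ps)
stack-row {k} {p = p} {ps} j st w≤p j<p eq =
  stack (isPartition-∷ (m<n⇒0<n j<p) ps≤p (isPartition st))
        (≤-refl ∷ ps≤p)
        (≤-trans (s≤s (hooks st)) (α-∷-< ps j j<p hook))
  where
  ps≤p = All.map (λ q≤w → ≤-trans q≤w w≤p) (bounded st)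
  hook : (p ∸ j) + colLength j ps ≡ k
  hook = +-cancelʳ-≡ j _ k (begin
    (p ∸ j) + colLength j ps + j   ≡⟨ solve 3 (λ a l j → a :+ l :+ j := a :+ j :+ l) refl (p ∸ j) _ j ⟩
    (p ∸ j) + j + colLength j ps   ≡⟨ cong (_+ colLength j ps) (m∸n+n≡m (<⇒≤ j<p)) ⟩
    p + colLength j ps             ≡⟨ eq ⟩
    k + j                          ∎)
    where open ≡-Reasoning

-- The columns j + x, for x < s, have length c in ps; the x-th new row has its
-- k-hook in column j + x, since by then that column has grown to x + c.
stack-rows : ∀ {k m n w p ps} s c j → Stack k m n w ps → w ≤ p → p + c ≡ k + j →
             (∀ {x} → x < s → j + x < p) → (∀ {x} → x < s → colLength (j + x) ps ≡ c) →
             Stack k (s + m) (s * p + n) p (replicate s p ++ ps)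
stack-rows zero c j st w≤p eq j<p col≡c =
  stack (isPartition st) (All.map (λ q≤w → ≤-trans q≤w w≤p) (bounded st)) (hooks st)
stack-rows {k} {m} {n} {w} {p} {ps} (suc s) c j st w≤p eq j<p col≡c =
  subst (λ n → Stack k (suc (s + m)) n p (p ∷ replicate s p ++ ps)) (sym (+-assoc p (s * p) n))
    (stack-row (j + s) below ≤-refl (j<p (n<1+n s)) (begin
      p + colLength (j + s) (replicate s p ++ ps)
        ≡⟨ cong (p +_) (colLength-replicate-++ s ps (j<p (n<1+n s))) ⟩
      p + (s + colLength (j + s) ps)
        ≡⟨ cong (λ l → p + (s + l)) (col≡c (n<1+n s)) ⟩
      p + (s + c)
        ≡⟨ solve 3 (λ p s c → p :+ (s :+ c) := p :+ c :+ s) refl p s c ⟩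
      p + c + s
        ≡⟨ cong (_+ s) eq ⟩
      k + j + s
        ≡⟨ +-assoc k j s ⟩
      k + (j + s) ∎))
  where
  open ≡-Reasoning
  below : Stack k (s + m) (s * p + n) p (replicate s p ++ ps)
  below = stack-rows s c j st w≤p eq (j<p ∘ m<n⇒m<1+n) (col≡c ∘ m<n⇒m<1+n)

-- Staircases and ways to add cells to them

area : ℕ → ℕ → ℕ
area k zero    = 0
area k (suc q) = k * (suc q * k) + area k q

-- The columns from `w` on are empty in `ps`, and the new rows cover `k` of them, enough to give
-- each of at most `k` rows its own column.
stack-block : ∀ {k m n w ps} z → z ≤ k → Stack k m n w ps →
              Stack k (z + m) (z * (k + w) + n) (k + w) (replicate z (k + w) ++ ps)
stack-block {k} {w = w} z z≤k st =
  stack-rows z 0 w st (m≤n+m w k) (+-identityʳ (k + w))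
    (λ {x} x<z → subst (w + x <_) (+-comm w k) (+-monoʳ-< w (<-≤-trans x<z z≤k)))
    (λ {x} _ → colLength-bounded (bounded st) (m≤m+n w x))

staircase : ∀ k q → ∃[ ps ] Stack k (q * k) (area k q) (q * k) ps
staircase k zero    = [] , empty
staircase k (suc q) = _ , stack-block k ≤-refl (proj₂ (staircase k q))

-- As `k ≤ d`, column `d + w` lies beyond every row below, so the hook there is just the last `k`
-- cells of the new row.
stack-long-row : ∀ {k m n w ps d} → k ≤ d → 0 < k → Stack k m n (k + w) ps →
                 Stack k (suc m) (d + (k + w) + n) (d + (k + w)) (d + (k + w) ∷ ps)
stack-long-row {k} {w = w} {ps} {d} k≤d 0<k st = stack-row (d + w) st (m≤n+m (k + w) d)
  (+-monoʳ-< d (m<n+m w 0<k))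
  (trans (cong (d + (k + w) +_) (colLength-bounded (bounded st) (+-monoˡ-≤ w k≤d)))
         (solve 3 (λ d k w → d :+ (k :+ w) :+ con 0 := k :+ (d :+ w)) refl d k w))

-- On top of ps: z rows of length k + w, then e rows longer by b, then one row
-- longer by a.
stack-short-rows : ∀ {k m n w ps} z e {a b} → b ≤ a → z + e + a < k → Stack k m n w ps →
  ∃[ qs ] Stack k (suc (e + (z + m)))
            (a + (k + w) + (e * (b + (k + w)) + (z * (k + w) + n))) (a + (k + w)) qs
stack-short-rows {k} {m} {n} {w} {ps} z e {a} {b} b≤a z+e+a<k st = _ ,
  -- This column lies in `w ≤ j < k + w`, so exactly the `e + z` new rows below reach it; the top
  -- row has `k ∸ (z + e)` cells from it on.
  stack-row (z + e + a + w) upper (+-monoˡ-≤ (k + w) b≤a)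
    (<-≤-trans (+-monoˡ-< w z+e+a<k) (m≤n+m (k + w) a))
    (trans (cong (a + (k + w) +_) col)
           (solve 5 (λ a k w e z → a :+ (k :+ w) :+ (e :+ z) := k :+ (z :+ e :+ a :+ w))
                    refl a k w e z))
  where
  col-lower : ∀ {j} → w ≤ j → j < k + w → colLength j (replicate z (k + w) ++ ps) ≡ z
  col-lower {j} w≤j j<p = trans (colLength-replicate-++ z ps j<p)
    (trans (cong (z +_) (colLength-bounded (bounded st) w≤j)) (+-identityʳ z))

  lower : Stack k (z + m) (z * (k + w) + n) (k + w) (replicate z (k + w) ++ ps)
  lower = stack-block z (≤-trans (m≤m+n z e) (≤-trans (m≤m+n (z + e) a) (<⇒≤ z+e+a<k))) st

  column< : ∀ {x} → x < e → b + z + w + x < k + w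
  column< {x} x<e = begin-strict
    b + z + w + x     ≡⟨ solve 4 (λ b z w x → b :+ z :+ w :+ x := z :+ x :+ b :+ w) refl b z w x ⟩
    z + x + b + w     ≤⟨ +-monoˡ-≤ w (+-mono-≤ (+-monoʳ-≤ z (<⇒≤ x<e)) b≤a) ⟩
    z + e + a + w     <⟨ +-monoˡ-< w z+e+a<k ⟩
    k + w             ∎
    where open ≤-Reasoning

  upper : Stack k (e + (z + m)) (e * (b + (k + w)) + (z * (k + w) + n)) (b + (k + w)) _
  -- From column `b + z + w` a row of length `b + (k + w)` has `k ∸ z` cells left, and the `z` rows
  -- below supply the rest of the hook.
  upper = stack-rows e z (b + z + w) lower (m≤n+m (k + w) b)
    (solve 4 (λ b k w z → b :+ (k :+ w) :+ z := k :+ (b :+ z :+ w)) refl b k w z)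
    (λ x<e → <-≤-trans (column< x<e) (m≤n+m (k + w) b))
    (λ {x} x<e → col-lower (≤-trans (m≤n+m w (b + z)) (m≤m+n _ x)) (column< x<e))

  col : colLength (z + e + a + w) (replicate e (b + (k + w)) ++ replicate z (k + w) ++ ps) ≡ e + z
  col = trans
    (colLength-replicate-++ e (replicate z (k + w) ++ ps)
      (<-≤-trans (+-monoˡ-< w z+e+a<k) (m≤n+m (k + w) b)))
    (cong (e +_) (col-lower (m≤n+m w (z + e + a)) (+-monoˡ-< w z+e+a<k)))

-- Here `g` is k - 1 - d. The top row is kept apart because it alone exceeds `q * k`: the next block
-- then finds height 1 in the `d` columns from `q * k` on and height 0 after them. Within a block,
-- `d` rows lose a cell and one row gains `d`, so only the bottom row adds to the area.
shifted-staircase : ∀ d g q → 0 < d → let k = suc (d + g) in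
  ∃[ ps ] All (_≤ q * k) ps × Stack k (q * k) (d + area k q) (d + q * k) (d + q * k ∷ ps)
shifted-staircase d g zero 0<d =
  [] , [] , stack (≤-trans 0<d (m≤m+n d 0) ∷ [] , [-] , +-identityʳ (d + 0)) (≤-refl ∷ []) z≤n
shifted-staircase d g (suc q) 0<d with shifted-staircase d g q 0<d
... | ps , ps≤w , st = _ , bounded middle ,
  subst₂ (λ m n → Stack k m n (d + (k + w)) (d + (k + w) ∷ rest)) hooks≡ area≡
    (stack-row (d + g + w) middle (m≤n+m (k + w) d)
      (≤-trans (n<1+n (d + g + w)) (m≤n+m (k + w) d))
      (trans (cong (d + (k + w) +_) col)
             (solve 4 (λ d k w g → d :+ (k :+ w) :+ g := k :+ (d :+ g :+ w)) refl d k w g)))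
  where
  k = suc (d + g)
  w = q * k
  v = d + g + w
  rest = replicate g (k + w) ++ replicate d v ++ d + w ∷ ps

  lower : Stack k (d + w) (d * v + (d + area k q)) v _
  -- The single cell below, from the row of length `d + w`, makes up for the cell that each of these
  -- rows lacks.
  lower = stack-rows d 1 w st (+-monoˡ-≤ w (m≤m+n d g)) (+-comm v 1)
    (λ {x} x<d → subst (w + x <_) (+-comm w (d + g)) (+-monoʳ-< w (<-≤-trans x<d (m≤m+n d g))))
    (λ {x} x<d → trans (colLength-∷ ps (subst (w + x <_) (+-comm w d) (+-monoʳ-< w x<d)))
                       (cong suc (colLength-bounded ps≤w (m≤m+n w x))))

  column< : ∀ {x} → x < g → d + w + x < v
  column< {x} x<g = subst (d + w + x <_)
    (solve 3 (λ d w g → d :+ w :+ g := d :+ g :+ w) refl d w g) (+-monoʳ-< (d + w) x<g)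

  middle : Stack k (g + (d + w)) (g * (k + w) + (d * v + (d + area k q))) (k + w) _
  -- The columns from `d + w` up to `v` contain the `d` shortened rows and nothing else.
  middle = stack-rows g d (d + w) lower (n≤1+n v)
    (solve 3 (λ k w d → k :+ w :+ d := k :+ (d :+ w)) refl k w d)
    (λ x<g → m<n⇒m<1+n (column< x<g))
    (λ {x} x<g → trans (colLength-replicate-++ d (d + w ∷ ps) (column< x<g))
      (trans (cong (d +_) (colLength-bounded (bounded st) (m≤m+n (d + w) x))) (+-identityʳ d)))

  col : colLength v rest ≡ g
  col = trans (colLength-replicate-++ g (replicate d v ++ d + w ∷ ps) (n<1+n v))
    (trans (cong (g +_) (colLength-bounded (bounded lower) ≤-refl)) (+-identityʳ g))

  hooks≡ : suc (g + (d + w)) ≡ k + w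
  hooks≡ = solve 3 (λ g d w → con 1 :+ (g :+ (d :+ w)) := con 1 :+ (d :+ g) :+ w) refl g d w

  area≡ : d + (k + w) + (g * (k + w) + (d * v + (d + area k q))) ≡ d + (k * (k + w) + area k q)
  area≡ = solve 4 (λ d g w A → let k = con 1 :+ (d :+ g) in
    d :+ (k :+ w) :+ (g :* (k :+ w) :+ (d :* (d :+ g :+ w) :+ (d :+ A)))
      := d :+ (k :* (k :+ w) :+ A)) refl d g w (area k q)

-- The closed form of t(m, k)

2*area : ∀ k q → area k q + area k q ≡ q * (q + 1) * (k * k)
2*area k zero    = refl
2*area k (suc q) = begin
  k * (suc q * k) + A + (k * (suc q * k) + A)
    ≡⟨ solve 3 (λ k q A → k :* ((con 1 :+ q) :* k) :+ A :+ (k :* ((con 1 :+ q) :* k) :+ A)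
                       := k :* ((con 1 :+ q) :* k) :+ k :* ((con 1 :+ q) :* k) :+ (A :+ A)) refl k q A ⟩
  k * (suc q * k) + k * (suc q * k) + (A + A)
    ≡⟨ cong (k * (suc q * k) + k * (suc q * k) +_) (2*area k q) ⟩
  k * (suc q * k) + k * (suc q * k) + q * (q + 1) * (k * k)
    ≡⟨ solve 2 (λ k q → k :* ((con 1 :+ q) :* k) :+ k :* ((con 1 :+ q) :* k) :+ q :* (q :+ con 1) :* (k :* k)
                     := (con 1 :+ q) :* (con 1 :+ q :+ con 1) :* (k :* k)) refl k q ⟩
  suc q * (suc q + 1) * (k * k) ∎
  where
  open ≡-Reasoning
  A = area k q

binomial≡area : ∀ k q → ((q + 1) C 2) * k ^ 2 ≡ area k q
binomial≡area k zero    = refl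
binomial≡area k (suc q) = begin
  ((suc q + 1) C 2) * k ^ 2
    ≡⟨ cong (_* k ^ 2) (sym (nCk+nC[k+1]≡[n+1]C[k+1] (q + 1) 1)) ⟩
  ((q + 1) C 1 + (q + 1) C 2) * k ^ 2
    ≡⟨ cong (λ c → (c + (q + 1) C 2) * k ^ 2) (trans (nC1≡n (q + 1)) (+-comm q 1)) ⟩
  (suc q + (q + 1) C 2) * k ^ 2
    ≡⟨ solve 3 (λ q c k → (con 1 :+ q :+ c) :* k :^ 2 := k :* ((con 1 :+ q) :* k) :+ c :* k :^ 2)
               refl q ((q + 1) C 2) k ⟩
  k * (suc q * k) + ((q + 1) C 2) * k ^ 2
    ≡⟨ cong (k * (suc q * k) +_) (binomial≡area k q) ⟩
  k * (suc q * k) + area k q ∎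
  where open ≡-Reasoning

-- With `m = r + q * k`, the product `m * (q + 1) * k` is `r * (suc q * k)` plus twice the staircase
-- area, and the binomial term removes that area once.
t-closed-< : ∀ k .{{_ : NonZero k}} q {r} → r < k → t (r + q * k) k ≡ r * (suc q * k) + area k q
t-closed-< k q {r} r<k = +-cancelʳ-≡ (area k q) _ _ (begin
  t m k + area k q                            ≡⟨ cong (t m k +_) (binomial≡area k q) ⟨
  t m k + ((q + 1) C 2) * k ^ 2               ≡⟨ cong (λ q → t m k + ((q + 1) C 2) * k ^ 2) m/k≡q ⟨
  t m k + ((m / k + 1) C 2) * k ^ 2           ≡⟨ t-exact m k ⟩
  m * (m / k + 1) * k                         ≡⟨ cong (λ q → m * (q + 1) * k) m/k≡q ⟩
  m * (q + 1) * k                             ≡⟨ solve 3 (λ r q k → (r :+ q :* k) :* (q :+ con 1) :* k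
                                                   := r :* ((con 1 :+ q) :* k) :+ q :* (q :+ con 1) :* (k :* k)) refl r q k ⟩
  r * (suc q * k) + q * (q + 1) * (k * k)     ≡⟨ cong (r * (suc q * k) +_) (2*area k q) ⟨
  r * (suc q * k) + (area k q + area k q)     ≡⟨ +-assoc (r * (suc q * k)) (area k q) (area k q) ⟨
  r * (suc q * k) + area k q + area k q       ∎)
  where
  open ≡-Reasoning
  m = r + q * k
  m/k≡q : m / k ≡ q
  m/k≡q = trans (+-distrib-/-∣ʳ r (divides-refl q)) (cong₂ _+_ (m<n⇒m/n≡0 r<k) (m*n/n≡m q k))

t-closed-≤ : ∀ k .{{_ : NonZero k}} q {r} → r ≤ k → t (r + q * k) k ≡ r * (suc q * k) + area k q
t-closed-≤ k q r≤k with m≤n⇒m<n∨m≡n r≤k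
... | inj₁ r<k  = t-closed-< k q r<k
-- For `r = k` the quotient is `suc q` with remainder 0, and `area k (suc q)` unfolds to the
-- required sum.
... | inj₂ refl = t-closed-< k (suc q) (>-nonZero⁻¹ k)

-- The lower bound for b(n, k)

stack⇒≤b : ∀ {k m n w ps} → Stack k m n w ps → b n k ≥ m
stack⇒≤b {k} {n = n} st = ≤-trans (hooks st) (b-upper n k (isPartition st))

b-above-t : ∀ k q r d → r < k → b (d + (suc r * (suc q * k) + area k q)) k ≥ suc r + q * k
b-above-t k q r d r<k = cases (k ≤? d) (suc r + d ≤? k)
  where
  Goal = b (d + (suc r * (suc q * k) + area k q)) k ≥ suc r + q * k
  base = proj₂ (staircase k q)

  one-row : b (d + suc q * k + (r * (suc q * k) + area k q)) k ≥ suc r + q * k → Goal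
  one-row = subst (λ n → b n k ≥ suc r + q * k)
    (solve 4 (λ d p r A → d :+ p :+ (r :* p :+ A) := d :+ ((con 1 :+ r) :* p :+ A))
             refl d (suc q * k) r (area k q))

  full-block : suc r ≡ k → 0 < d → d < k → Goal
  full-block refl 0<d d<k with m≤n⇒∃[o]m+o≡n d<k
  -- The `k` top rows complete the staircase to `suc q` blocks, all of which are shifted.
  ... | g , refl = stack⇒≤b (proj₂ (proj₂ (shifted-staircase d g (suc q) 0<d)))

  partial-block : suc r < k → k < suc r + d → d < k → Goal
  -- The top row takes `suc a`, which is k - (r + 1), of the extra cells; `e` cells remain, and
  -- `d < k` forces `e ≤ r`, so they fit one each on `e` of the other `r` rows, leaving `z` rows
  -- unchanged.
  partial-block r+1<k k<r+1+d d<k with m≤n⇒∃[o]m+o≡n r+1<k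
  ... | a , refl with m≤n⇒∃[o]m+o≡n {suc a} {d} (+-cancelˡ-≤ (suc r) (suc a) d
                        (<⇒≤ (subst (_< suc r + d) (sym (+-suc (suc r) a)) k<r+1+d)))
  ...   | e , refl with m≤n⇒∃[o]m+o≡n {e} {r} (+-cancelˡ-≤ (suc a) e r
                          (≤-pred (subst (suc a + e <_) (cong (2 +_) (+-comm r a)) d<k)))
  ...     | z , refl =
    subst₂ (λ m n → b n k ≥ suc m) (sym (+-assoc e z (q * k)))
      (solve 5 (λ a p e z A → con 1 :+ a :+ p :+ (e :* (con 1 :+ p) :+ (z :* p :+ A))
                           := con 1 :+ a :+ e :+ ((con 1 :+ (e :+ z)) :* p :+ A))
               refl a (suc q * k) e z (area k q))
      (stack⇒≤b (proj₂ (stack-short-rows z e {suc a} {1} (s≤s z≤n)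
        (≤-reflexive (cong suc (solve 3 (λ z e a → z :+ e :+ (con 1 :+ a) := con 1 :+ (e :+ z :+ a))
                                        refl z e a)))
        base)))

  cases : Dec (k ≤ d) → Dec (suc r + d ≤ k) → Goal
  cases (yes k≤d) _ =
    one-row (stack⇒≤b (stack-long-row k≤d (m<n⇒0<n r<k) (stack-block r (<⇒≤ r<k) base)))
  cases (no k≰d) (yes r+1+d≤k) =
    one-row (stack⇒≤b (proj₂ (stack-short-rows r 0 {d} {0} z≤n
      (subst (λ r → r + d < k) (sym (+-identityʳ r)) r+1+d≤k) base)))
  cases (no k≰d) (no r+1+d≰k) with m≤n⇒m<n∨m≡n r<k
  ... | inj₁ r+1<k = partial-block r+1<k (≰⇒> r+1+d≰k) (≰⇒> k≰d)
  ... | inj₂ r+1≡k = full-block r+1≡k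
    (+-cancelˡ-< (suc r) 0 d
      (subst (_< suc r + d) (sym (trans (+-identityʳ (suc r)) r+1≡k)) (≰⇒> r+1+d≰k)))
    (≰⇒> k≰d)

theorem4p2 : (m k n : ℕ) .{{_ : NonZero k}} → n ≥ t m k → b n k ≥ m
theorem4p2 zero    k n _ = z≤n
theorem4p2 (suc m) k n n≥t =
  subst (λ m → b n k ≥ suc m) (sym m≡)
    (subst (λ n → b n k ≥ suc (m % k) + m / k * k)
      (trans (cong (n ∸ t (suc m) k +_) (sym t≡)) (m∸n+n≡m n≥t))
      (b-above-t k (m / k) (m % k) (n ∸ t (suc m) k) (m%n<n m k)))
  where
  -- Dividing the predecessor `m` of the target `suc m` makes the number `suc (m % k)` of top rows
  -- lie between 1 and `k`, so there is always a top row.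
  m≡ : m ≡ m % k + m / k * k
  m≡ = m≡m%n+[m/n]*n m k
  t≡ : t (suc m) k ≡ suc (m % k) * (suc (m / k) * k) + area k (m / k)
  t≡ = trans (cong (λ m → t (suc m) k) m≡) (t-closed-≤ k (m / k) (m%n<n m k))
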